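{- Let $(r_k)_{k\ge 1}$, $(s_k)_{k\ge 0}$, $(t_k)_{k\ge 1}$ be sequences of nonnegative real numbers, and let $A=[a_{n,k}]_{n,k\ge 0}$ be the infinite lower triangular matrix with $a_{n,k}=0$ unless $n\ge k\ge 0$, defined by $$a_{0,0}=1,\quad a_{n+1,0}=s_0a_{n,0}+t_1a_{n,1},\quad a_{n+1,k}=r_{k}a_{n,k-1}+s_ka_{n,k}+t_{k+1}a_{n,k+1}\quad (k\ge 1,\ n\ge 0).$$ (i) If $s_0\ge r_1$ and $s_k\ge r_{k+1}+t_{k}$ for all $k\ge 1$, then $A$ is TP. (ii) If $s_0\ge t_1$ and $s_k\ge r_k+t_{k+1}$ for all $k\ge 1$, then $A$ is TP.
   Context: A real (finite or infinite) matrix is TP (totally positive) if its minors of all orders are nonnegative. -}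

module Defs where

open import Algebra.Bundles.Raw using (RawRing)
open import Data.Fin.Base as Fin using (Fin; zero; suc; toℕ; punchIn)
open import Data.Nat.Base as ℕ using (ℕ; zero; suc)
import Data.Nat.Properties as ℕₚ
open import Data.Product using (∃; _×_; _,_)
open import Data.Rational.Base as ℚ using (ℚ; 0ℚ; 1ℚ; ½)
import Data.Rational.Properties as ℚₚ
open import Data.Rational.Solver using (module +-*-Solver)
open import Level using (0ℓ)
open import Relation.Binary.Core using (_Preserves_⟶_)
open import Relation.Binary.PropositionalEquality
  using (_≡_; refl; cong; cong₂; sym; trans; subst; module ≡-Reasoning)

-- The real numbers, as Cauchy sequences of rationals; _≈_ is equality of
-- reals.

IsCauchy : (ℕ → ℚ) → Set
IsCauchy x = ∀ ε → 0ℚ ℚ.< ε →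
  ∃ λ N → ∀ m n → N ℕ.≤ m → N ℕ.≤ n → ℚ.∣ x m ℚ.- x n ∣ ℚ.< ε

record ℝ : Set where
  constructor mkℝ
  field
    seq    : ℕ → ℚ
    cauchy : IsCauchy seq

open ℝ public

infix 4 _≈_ _≤_

_≈_ : ℝ → ℝ → Set
x ≈ y = ∀ ε → 0ℚ ℚ.< ε →
  ∃ λ N → ∀ n → N ℕ.≤ n → ℚ.∣ seq x n ℚ.- seq y n ∣ ℚ.< ε

_≤_ : ℝ → ℝ → Set
x ≤ y = ∀ ε → 0ℚ ℚ.< ε →
  ∃ λ N → ∀ n → N ℕ.≤ n → seq x n ℚ.< seq y n ℚ.+ ε

module CauchyLemmas where
  half-pos : ∀ {ε} → 0ℚ ℚ.< ε → 0ℚ ℚ.< ε ℚ.* ½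
  half-pos {ε} 0<ε = subst (ℚ._< ε ℚ.* ½) (ℚₚ.*-zeroˡ ½) (ℚₚ.*-monoˡ-<-pos ½ 0<ε)

  halves : ∀ ε → ε ℚ.* ½ ℚ.+ ε ℚ.* ½ ≡ ε
  halves ε = trans (sym (ℚₚ.*-distribˡ-+ ε ½ ½)) (ℚₚ.*-identityʳ ε)

  ∣p-p∣≡0 : ∀ p → ℚ.∣ p ℚ.- p ∣ ≡ 0ℚ
  ∣p-p∣≡0 p = cong ℚ.∣_∣ (ℚₚ.+-inverseʳ p)

  const-cauchy : ∀ q → IsCauchy (λ _ → q)
  const-cauchy q ε 0<ε = 0 , λ _ _ _ _ → subst (ℚ._< ε) (sym (∣p-p∣≡0 q)) 0<ε

  +-cauchy : ∀ {x y} → IsCauchy x → IsCauchy y → IsCauchy (λ n → x n ℚ.+ y n)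
  +-cauchy {x} {y} cx cy ε 0<ε
    with cx (ε ℚ.* ½) (half-pos 0<ε) | cy (ε ℚ.* ½) (half-pos 0<ε)
  ... | M , p | N , q = M ℕ.⊔ N , λ m n h k → begin-strict
      ℚ.∣ (x m ℚ.+ y m) ℚ.- (x n ℚ.+ y n) ∣
    ≡⟨ cong ℚ.∣_∣ (regroup (x m) (y m) (x n) (y n)) ⟩
      ℚ.∣ (x m ℚ.- x n) ℚ.+ (y m ℚ.- y n) ∣
    ≤⟨ ℚₚ.∣p+q∣≤∣p∣+∣q∣ (x m ℚ.- x n) (y m ℚ.- y n) ⟩
      ℚ.∣ x m ℚ.- x n ∣ ℚ.+ ℚ.∣ y m ℚ.- y n ∣
    <⟨ ℚₚ.+-mono-<
         (p m n (ℕₚ.m⊔n≤o⇒m≤o M N h) (ℕₚ.m⊔n≤o⇒m≤o M N k))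
         (q m n (ℕₚ.m⊔n≤o⇒n≤o M N h) (ℕₚ.m⊔n≤o⇒n≤o M N k)) ⟩
      ε ℚ.* ½ ℚ.+ ε ℚ.* ½
    ≡⟨ halves ε ⟩
      ε ∎
    where
    open ℚₚ.≤-Reasoning
    regroup : ∀ a b c d →
      (a ℚ.+ b) ℚ.- (c ℚ.+ d) ≡ (a ℚ.- c) ℚ.+ (b ℚ.- d)
    regroup = solve 4
      (λ a b c d → (a :+ b) :- (c :+ d) := (a :- c) :+ (b :- d)) refl
      where open +-*-Solver

  neg-cauchy : ∀ {x} → IsCauchy x → IsCauchy (λ n → ℚ.- x n)
  neg-cauchy {x} cx ε 0<ε with cx ε 0<ε
  ... | N , p = N , λ m n h k → subst (ℚ._< ε) (sym (flip-sign m n)) (p m n h k)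
    where
    flip-sign : ∀ m n → ℚ.∣ (ℚ.- x m) ℚ.- (ℚ.- x n) ∣ ≡ ℚ.∣ x m ℚ.- x n ∣
    flip-sign m n = trans
      (cong ℚ.∣_∣ (sym (ℚₚ.neg-distrib-+ (x m) (ℚ.- x n))))
      (ℚₚ.∣-p∣≡∣p∣ (x m ℚ.- x n))

  bounded : ∀ {x} → IsCauchy x →
    ∃ λ B → 0ℚ ℚ.< B × ∃ λ N → ∀ n → N ℕ.≤ n → ℚ.∣ x n ∣ ℚ.≤ B
  bounded {x} cx with cx 1ℚ (ℚₚ.positive⁻¹ 1ℚ)
  ... | N , p =
      1ℚ ℚ.+ ℚ.∣ x N ∣
    , ℚₚ.+-mono-<-≤ (ℚₚ.positive⁻¹ 1ℚ) (ℚₚ.0≤∣p∣ (x N))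
    , N , λ n h → begin
      ℚ.∣ x n ∣
    ≡⟨ cong ℚ.∣_∣ (split (x n) (x N)) ⟩
      ℚ.∣ (x n ℚ.- x N) ℚ.+ x N ∣
    ≤⟨ ℚₚ.∣p+q∣≤∣p∣+∣q∣ (x n ℚ.- x N) (x N) ⟩
      ℚ.∣ x n ℚ.- x N ∣ ℚ.+ ℚ.∣ x N ∣
    ≤⟨ ℚₚ.+-monoˡ-≤ ℚ.∣ x N ∣ (ℚₚ.<⇒≤ (p n N h ℕₚ.≤-refl)) ⟩
      1ℚ ℚ.+ ℚ.∣ x N ∣ ∎
    where
    open ℚₚ.≤-Reasoning
    split : ∀ a b → a ≡ (a ℚ.- b) ℚ.+ b
    split = solve 2 (λ a b → a := (a :- b) :+ b) refl
      where open +-*-Solver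

  divide : ∀ {B ε} → 0ℚ ℚ.< B → 0ℚ ℚ.< ε → ∃ λ δ → 0ℚ ℚ.< δ × B ℚ.* δ ≡ ε
  divide {B} {ε} 0<B 0<ε =
      1/B ℚ.* ε
    , ℚₚ.positive⁻¹ (1/B ℚ.* ε) {{ℚₚ.pos*pos⇒pos 1/B {{ℚₚ.1/pos⇒pos B {{posB}}}} ε {{ℚ.positive 0<ε}}}}
    , (begin
        B ℚ.* (1/B ℚ.* ε)  ≡⟨ ℚₚ.*-assoc B 1/B ε ⟨
        B ℚ.* 1/B ℚ.* ε    ≡⟨ cong (ℚ._* ε) (ℚₚ.*-inverseʳ B {{nzB}}) ⟩
        1ℚ ℚ.* ε           ≡⟨ ℚₚ.*-identityˡ ε ⟩
        ε                  ∎)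
    where
    open ≡-Reasoning
    posB : ℚ.Positive B
    posB = ℚ.positive 0<B
    nzB : ℚ.NonZero B
    nzB = ℚₚ.pos⇒nonZero B {{posB}}
    1/B : ℚ
    1/B = ℚ.1/_ B {{nzB}}

  ∣*∣-bound : ∀ {a b B δ} → 0ℚ ℚ.< B → ℚ.∣ a ∣ ℚ.≤ B → ℚ.∣ b ∣ ℚ.< δ →
    ℚ.∣ a ℚ.* b ∣ ℚ.< B ℚ.* δ
  ∣*∣-bound {a} {b} {B} {δ} 0<B a≤B b<δ = begin-strict
      ℚ.∣ a ℚ.* b ∣
    ≡⟨ ℚₚ.∣p*q∣≡∣p∣*∣q∣ a b ⟩
      ℚ.∣ a ∣ ℚ.* ℚ.∣ b ∣
    ≤⟨ ℚₚ.*-monoʳ-≤-nonNeg ℚ.∣ b ∣ {{ℚ.nonNegative (ℚₚ.0≤∣p∣ b)}} a≤B ⟩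
      B ℚ.* ℚ.∣ b ∣
    <⟨ ℚₚ.*-monoʳ-<-pos B {{ℚ.positive 0<B}} b<δ ⟩
      B ℚ.* δ ∎
    where open ℚₚ.≤-Reasoning

  *-diff-bound : ∀ {a b c d A B α β} → 0ℚ ℚ.< A → 0ℚ ℚ.< B →
    ℚ.∣ a ∣ ℚ.≤ A → ℚ.∣ d ∣ ℚ.≤ B → ℚ.∣ b ℚ.- d ∣ ℚ.< α → ℚ.∣ a ℚ.- c ∣ ℚ.< β →
    ℚ.∣ a ℚ.* b ℚ.- c ℚ.* d ∣ ℚ.< A ℚ.* α ℚ.+ B ℚ.* β
  *-diff-bound {a} {b} {c} {d} {A} {B} {α} {β} 0<A 0<B a≤A d≤B b-d<α a-c<β =
    begin-strict
      ℚ.∣ a ℚ.* b ℚ.- c ℚ.* d ∣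
    ≡⟨ cong ℚ.∣_∣ (regroup a b c d) ⟩
      ℚ.∣ a ℚ.* (b ℚ.- d) ℚ.+ d ℚ.* (a ℚ.- c) ∣
    ≤⟨ ℚₚ.∣p+q∣≤∣p∣+∣q∣ (a ℚ.* (b ℚ.- d)) (d ℚ.* (a ℚ.- c)) ⟩
      ℚ.∣ a ℚ.* (b ℚ.- d) ∣ ℚ.+ ℚ.∣ d ℚ.* (a ℚ.- c) ∣
    <⟨ ℚₚ.+-mono-<
         (∣*∣-bound {a} {b ℚ.- d} {A} {α} 0<A a≤A b-d<α)
         (∣*∣-bound {d} {a ℚ.- c} {B} {β} 0<B d≤B a-c<β) ⟩
      A ℚ.* α ℚ.+ B ℚ.* β ∎
    where
    open ℚₚ.≤-Reasoning
    regroup : ∀ a b c d →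
      a ℚ.* b ℚ.- c ℚ.* d ≡ a ℚ.* (b ℚ.- d) ℚ.+ d ℚ.* (a ℚ.- c)
    regroup = solve 4
      (λ a b c d → a :* b :- c :* d := a :* (b :- d) :+ d :* (a :- c)) refl
      where open +-*-Solver

  *-cauchy : ∀ {x y} → IsCauchy x → IsCauchy y → IsCauchy (λ n → x n ℚ.* y n)
  *-cauchy {x} {y} cx cy ε 0<ε =
    let A , 0<A , K , x≤A = bounded cx
        B , 0<B , L , y≤B = bounded cy
        α , 0<α , Aα      = divide {A} 0<A (half-pos 0<ε)
        β , 0<β , Bβ      = divide {B} 0<B (half-pos 0<ε)
        M , p             = cx β 0<β
        N , q             = cy α 0<α
    in (K ℕ.⊔ L) ℕ.⊔ (M ℕ.⊔ N) , λ m n h k →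
    let hKL = ℕₚ.m⊔n≤o⇒m≤o (K ℕ.⊔ L) (M ℕ.⊔ N) h
        kKL = ℕₚ.m⊔n≤o⇒m≤o (K ℕ.⊔ L) (M ℕ.⊔ N) k
        hMN = ℕₚ.m⊔n≤o⇒n≤o (K ℕ.⊔ L) (M ℕ.⊔ N) h
        kMN = ℕₚ.m⊔n≤o⇒n≤o (K ℕ.⊔ L) (M ℕ.⊔ N) k
    in subst (ℚ.∣ x m ℚ.* y m ℚ.- x n ℚ.* y n ∣ ℚ.<_)
         (trans (cong₂ ℚ._+_ Aα Bβ) (halves ε))
         (*-diff-bound {x m} {y m} {x n} {y n} {A} {B} {α} {β} 0<A 0<B
           (x≤A m (ℕₚ.m⊔n≤o⇒m≤o K L hKL))
           (y≤B n (ℕₚ.m⊔n≤o⇒n≤o K L kKL))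
           (q m n (ℕₚ.m⊔n≤o⇒n≤o M N hMN) (ℕₚ.m⊔n≤o⇒n≤o M N kMN))
           (p m n (ℕₚ.m⊔n≤o⇒m≤o M N hMN) (ℕₚ.m⊔n≤o⇒m≤o M N kMN)))

open CauchyLemmas

infixl 6 _+_
infixl 7 _*_
infix  8 -_

0ℝ 1ℝ : ℝ
0ℝ = mkℝ (λ _ → 0ℚ) (const-cauchy 0ℚ)
1ℝ = mkℝ (λ _ → 1ℚ) (const-cauchy 1ℚ)

_+_ _*_ : ℝ → ℝ → ℝ
x + y = mkℝ (λ n → seq x n ℚ.+ seq y n) (+-cauchy {seq x} {seq y} (cauchy x) (cauchy y))
x * y = mkℝ (λ n → seq x n ℚ.* seq y n) (*-cauchy {seq x} {seq y} (cauchy x) (cauchy y))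

-_ : ℝ → ℝ
- x = mkℝ (λ n → ℚ.- seq x n) (neg-cauchy {seq x} (cauchy x))

ℝ-rawRing : RawRing 0ℓ 0ℓ
ℝ-rawRing = record
  { Carrier = ℝ ; _≈_ = _≈_
  ; _+_ = _+_ ; _*_ = _*_ ; -_ = -_ ; 0# = 0ℝ ; 1# = 1ℝ
  }

module Determinant {c ℓ} (R : RawRing c ℓ) where
  open RawRing R
    using (Carrier; rawSemiring; 1#)
    renaming (_*_ to _·_; -_ to neg)
  open import Algebra.Definitions.RawSemiring rawSemiring using (sum; _^_)

  -- Laplace expansion along the first row.
  det : ∀ {n} → (Fin n → Fin n → Carrier) → Carrier
  det {zero}  M = 1#
  det {suc n} M = sum λ j →
    (neg 1# ^ toℕ j) · M zero j · det (λ i k → M (suc i) (punchIn j k))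

open Determinant ℝ-rawRing public

InfiniteMatrix : Set
InfiniteMatrix = ℕ → ℕ → ℝ

Increasing : ∀ {m} → (Fin m → ℕ) → Set
Increasing f = f Preserves Fin._<_ ⟶ ℕ._<_

-- The instance m = 0 only adds the empty minor, which is 1.
IsTP : InfiniteMatrix → Set
IsTP a = ∀ {m} (rows cols : Fin m → ℕ) → Increasing rows → Increasing cols →
  0ℝ ≤ det (λ i j → a (rows i) (cols j))

-- Only r k and t k with k ≥ 1 occur; r 0 and t 0 are junk values.
recMatrix : (r s t : ℕ → ℝ) → InfiniteMatrix
recMatrix r s t zero    zero    = 1ℝ
recMatrix r s t zero    (suc k) = 0ℝ
recMatrix r s t (suc n) zero    = s 0 * recMatrix r s t n 0 + t 1 * recMatrix r s t n 1
recMatrix r s t (suc n) (suc k) =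
    r (suc k) * recMatrix r s t n k
  + s (suc k) * recMatrix r s t n (suc k)
  + t (suc (suc k)) * recMatrix r s t n (suc (suc k))

-- The recursion itself forces the entries above the diagonal to vanish.
recMatrix-lowerTriangular : ∀ r s t n k → n ℕ.< k → recMatrix r s t n k ≈ 0ℝ
recMatrix-lowerTriangular r s t n k n<k ε 0<ε = 0 , λ i _ →
  subst (λ q → ℚ.∣ q ℚ.- 0ℚ ∣ ℚ.< ε) (sym (seq≡0 n k n<k i)) 0<ε
  where
  open ≡-Reasoning
  collapse : ∀ a b c {x y z} → x ≡ 0ℚ → y ≡ 0ℚ → z ≡ 0ℚ →
    a ℚ.* x ℚ.+ b ℚ.* y ℚ.+ c ℚ.* z ≡ 0ℚ
  collapse a b c refl refl refl = begin
    a ℚ.* 0ℚ ℚ.+ b ℚ.* 0ℚ ℚ.+ c ℚ.* 0ℚ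
      ≡⟨ cong₂ ℚ._+_ (cong₂ ℚ._+_ (ℚₚ.*-zeroʳ a) (ℚₚ.*-zeroʳ b)) (ℚₚ.*-zeroʳ c) ⟩
    0ℚ ∎

  seq≡0 : ∀ n k → n ℕ.< k → ∀ i → seq (recMatrix r s t n k) i ≡ 0ℚ
  seq≡0 zero    (suc k) _           i = refl
  seq≡0 (suc n) (suc k) (ℕ.s≤s n<k) i =
    collapse (seq (r (suc k)) i) (seq (s (suc k)) i) (seq (t (suc (suc k))) i)
      (seq≡0 n k n<k i)
      (seq≡0 n (suc k) (ℕₚ.m≤n⇒m≤1+n n<k) i)
      (seq≡0 n (suc (suc k)) (ℕₚ.m≤n⇒m≤1+n (ℕₚ.m≤n⇒m≤1+n n<k)) i)

{-# OPTIONS --safe #-}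
module Submission where

-- Write J for the tridiagonal matrix with diagonal s 0, s 1, ..., superdiagonal
-- r 1, r 2, ... and subdiagonal t 1, t 2, ...: row n + 1 of A is row n of A
-- times J, and row 0 is the first unit vector.
--
-- Under either dominance hypothesis J is a product L U of a lower and an upper
-- bidiagonal matrix with nonnegative entries.  In case (i), L has diagonal d
-- and subdiagonal t, and U has unit diagonal and superdiagonal c, where
--     d 0 = s 0,   d k * c k = r (k + 1),   d (k + 1) = s (k + 1) - t (k + 1) * c k;
-- dominance keeps r (k + 1) no larger than d k, so that c k can be taken in
-- [0 , 1] even when the pivot d k vanishes.  Case (ii) is the transpose, with
-- the roles of r and t exchanged.  This is the content of the module Pivots.
--
-- Multiplying on the right by a bidiagonal matrix replaces every column by a
-- nonnegative combination of itself and a fixed neighbour.  Determinants are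
-- linear in each column, so a minor of the product is a nonnegative combination
-- of minors whose column indices are still weakly increasing; such a minor is a
-- minor of the original matrix, or has two equal adjacent columns and vanishes
-- (bidiagonal-minors).  By induction on a bound for the row indices, all minors
-- of A are nonnegative: those avoiding row 0 are minors of A L U with smaller
-- row indices, and one that uses row 0 reduces to these by Laplace expansion
-- (factorization⇒TP).
--
-- The factorization divides by pivots after testing whether they vanish, so it
-- is carried out over the rationals.  A real inequality says nothing about the
-- individual terms of the representing Cauchy sequences, but replacing r and t
-- by their positive parts and s by its maximum with the dominating sum gives
-- equal reals whose terms satisfy the hypotheses exactly at every index.  The
-- determinants of the modified matrix are then nonnegative term by term, and
-- they equal the original ones because all operations respect equality of reals.

open import Algebra.Bundles.Raw using (RawRing)
open import Algebra.Bundles using (CommutativeRing)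
import Algebra.Definitions.RawSemiring
open import Data.Bool.Base using (Bool; true; false; if_then_else_)
open import Data.Empty using (⊥-elim)
open import Data.Fin.Base as Fin using (Fin; zero; suc; toℕ; inject₁; punchIn; punchOut)
import Data.Fin.Properties as Finₚ
open import Data.Nat.Base as ℕ using (ℕ; zero; suc; s≤s; z≤n)
import Data.Nat.Properties as ℕₚ
open import Data.Product using (∃; _×_; _,_; proj₁; proj₂)
open import Data.Rational.Base as ℚ using (ℚ; 0ℚ; 1ℚ; ½)
import Data.Rational.Properties as ℚₚ
open import Data.Rational.Solver using (module +-*-Solver)
open import Data.Sum.Base using (inj₁; inj₂)
open import Data.Vec.Functional using (_∷_)
open import Function.Base using (_∘_)
open import Relation.Binary.PropositionalEquality
  using (_≡_; _≢_; refl; sym; trans; cong; cong₂; subst; subst₂)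
open import Relation.Nullary.Decidable.Core using (yes; no)
open import Defs using (module Determinant; Increasing)

-- Determinants

-- A relation between the elements of two rings that respects their operations
-- also relates determinants of related matrices.  Taking one ring and its
-- equality gives congruence of the determinant; taking the graph of a ring
-- homomorphism gives its compatibility with determinants.
module DeterminantRelation {c c′ ℓ ℓ′} (R : RawRing c ℓ) (S : RawRing c′ ℓ′) where
  private
    module R = RawRing R
    module S = RawRing S
    module DetR = Determinant R
    module DetS = Determinant S
    module OpsR = Algebra.Definitions.RawSemiring R.rawSemiring
    module OpsS = Algebra.Definitions.RawSemiring S.rawSemiring

  module _ {r} (_~_ : R.Carrier → S.Carrier → Set r)
    (0~0 : R.0# ~ S.0#) (1~1 : R.1# ~ S.1#) (-1~-1 : (R.- R.1#) ~ (S.- S.1#))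
    (+~+ : ∀ {x x′ y y′} → x ~ x′ → y ~ y′ → (x R.+ y) ~ (x′ S.+ y′))
    (*~* : ∀ {x x′ y y′} → x ~ x′ → y ~ y′ → (x R.* y) ~ (x′ S.* y′))
    where

    sum-related : ∀ {n} {f : Fin n → R.Carrier} {g : Fin n → S.Carrier} →
      (∀ i → f i ~ g i) → OpsR.sum f ~ OpsS.sum g
    sum-related {zero}  f~g = 0~0
    sum-related {suc n} f~g = +~+ (f~g zero) (sum-related (f~g ∘ suc))

    ^-related : ∀ {x y} → x ~ y → ∀ n → (x OpsR.^ n) ~ (y OpsS.^ n)
    ^-related x~y zero    = 1~1
    ^-related x~y (suc n) = *~* x~y (^-related x~y n)

    det-related : ∀ {n} {M : Fin n → Fin n → R.Carrier} {N : Fin n → Fin n → S.Carrier} →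
      (∀ i j → M i j ~ N i j) → DetR.det M ~ DetS.det N
    det-related {zero}  M~N = 1~1
    det-related {suc n} M~N = sum-related λ j →
      *~* (*~* (^-related -1~-1 (toℕ j)) (M~N zero j))
        (det-related λ i k → M~N (suc i) (punchIn j k))

module DeterminantProperties {c ℓ} (R : CommutativeRing c ℓ) where
  open CommutativeRing R hiding (zero) renaming (refl to ≈-refl; sym to ≈-sym; trans to ≈-trans)
  open Determinant rawRing using (det)
  open import Algebra.Properties.Semiring.Exp semiring using (_^_)
  open import Algebra.Properties.CommutativeMonoid.Sum +-commutativeMonoid
    using (sum; sum-cong-≋; sum-replicate-zero; ∑-distrib-+)
  open import Algebra.Properties.Semiring.Sum semiring using (*-distribˡ-sum)
  open import Algebra.Properties.Ring ring using (-1*x≈-x)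
  open import Relation.Binary.Reasoning.Setoid setoid
  open import Algebra.Solver.Ring.NaturalCoefficients.Default commutativeSemiring
    using (solve; _:=_; _:+_; _:*_)

  Matrix : ℕ → Set c
  Matrix n = Fin n → Fin n → Carrier

  -- Delete the first row and column j.
  minor : ∀ {n} → Matrix (suc n) → Fin (suc n) → Matrix n
  minor M j i k = M (suc i) (punchIn j k)

  det-cong : ∀ {n} {M N : Matrix n} → (∀ i j → M i j ≈ N i j) → det M ≈ det N
  det-cong = DeterminantRelation.det-related rawRing rawRing _≈_
    ≈-refl ≈-refl ≈-refl +-cong *-cong

  -- Linearity in column k: M, P and Q agree in all other columns.
  det-linear : ∀ {n} (k : Fin n) {M P Q : Matrix n} x y →
    (∀ i → M i k ≈ x * P i k + y * Q i k) →
    (∀ i j → j ≢ k → M i j ≈ P i j) → (∀ i j → j ≢ k → M i j ≈ Q i j) →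
    det M ≈ x * det P + y * det Q
  det-linear {suc n} k {M} {P} {Q} x y col M≈P M≈Q = begin
    det M
      ≈⟨ sum-cong-≋ split ⟩
    sum (λ j → x * term P j + y * term Q j)
      ≈⟨ ∑-distrib-+ (λ j → x * term P j) (λ j → y * term Q j) ⟩
    sum (λ j → x * term P j) + sum (λ j → y * term Q j)
      ≈⟨ +-cong (*-distribˡ-sum x (term P)) (*-distribˡ-sum y (term Q)) ⟨
    x * det P + y * det Q ∎
    where
    term : Matrix (suc n) → Fin (suc n) → Carrier
    term N j = (- 1#) ^ toℕ j * N zero j * det (minor N j)

    split : ∀ j → term M j ≈ x * term P j + y * term Q j
    split j with j Finₚ.≟ k
    ... | yes refl = begin
      ε * M zero k * det (minor M k)
        ≈⟨ *-congʳ (*-congˡ (col zero)) ⟩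
      ε * (x * P zero k + y * Q zero k) * det (minor M k)
        ≈⟨ solve 6 (λ e x y p q d → e :* (x :* p :+ y :* q) :* d :=
                      x :* (e :* p :* d) :+ y :* (e :* q :* d))
                   ≈-refl ε x y (P zero k) (Q zero k) (det (minor M k)) ⟩
      x * (ε * P zero k * det (minor M k)) + y * (ε * Q zero k * det (minor M k))
        ≈⟨ +-cong (*-congˡ (*-congˡ (det-cong λ i l → M≈P (suc i) _ (Finₚ.punchInᵢ≢i k l))))
                  (*-congˡ (*-congˡ (det-cong λ i l → M≈Q (suc i) _ (Finₚ.punchInᵢ≢i k l)))) ⟩
      x * term P k + y * term Q k ∎
      where ε = (- 1#) ^ toℕ k
    ... | no j≢k = begin
      ε * M zero j * det (minor M j)
        ≈⟨ *-congˡ (det-linear k′ x y col′ (off M≈P) (off M≈Q)) ⟩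
      ε * M zero j * (x * det (minor P j) + y * det (minor Q j))
        ≈⟨ solve 6 (λ e m x y p q → e :* m :* (x :* p :+ y :* q) :=
                      x :* (e :* m :* p) :+ y :* (e :* m :* q))
                   ≈-refl ε (M zero j) x y (det (minor P j)) (det (minor Q j)) ⟩
      x * (ε * M zero j * det (minor P j)) + y * (ε * M zero j * det (minor Q j))
        ≈⟨ +-cong (*-congˡ (*-congʳ (*-congˡ (M≈P zero j j≢k))))
                  (*-congˡ (*-congʳ (*-congˡ (M≈Q zero j j≢k)))) ⟩
      x * term P j + y * term Q j ∎
      where
      ε = (- 1#) ^ toℕ j
      k′ = punchOut j≢k
      jk′≡k : punchIn j k′ ≡ k
      jk′≡k = Finₚ.punchIn-punchOut j≢k
      col′ : ∀ i → minor M j i k′ ≈ x * minor P j i k′ + y * minor Q j i k′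
      col′ i = subst (λ l → M (suc i) l ≈ x * P (suc i) l + y * Q (suc i) l)
                 (sym jk′≡k) (col (suc i))
      off : ∀ {N} → (∀ i j → j ≢ k → M i j ≈ N i j) →
            ∀ i l → l ≢ k′ → minor M j i l ≈ minor N j i l
      off M≈N i l l≢k′ = M≈N (suc i) (punchIn j l) λ jl≡k →
        l≢k′ (Finₚ.punchIn-injective j l k′ (trans jl≡k (sym jk′≡k)))

  sum-zero : ∀ {n} {f : Fin n → Carrier} → (∀ k → f k ≈ 0#) → sum f ≈ 0#
  sum-zero {n} f≈0 = ≈-trans (sum-cong-≋ f≈0) (sum-replicate-zero n)

  sum-adjacent-cancel : ∀ {n} (j : Fin n) (f : Fin (suc n) → Carrier) →
    f (inject₁ j) + f (suc j) ≈ 0# →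
    (∀ k → k ≢ inject₁ j → k ≢ suc j → f k ≈ 0#) → sum f ≈ 0#
  sum-adjacent-cancel zero f cancel others = begin
    f zero + (f (suc zero) + sum (λ k → f (suc (suc k))))
      ≈⟨ +-assoc _ _ _ ⟨
    f zero + f (suc zero) + sum (λ k → f (suc (suc k)))
      ≈⟨ +-cong cancel (sum-zero λ k → others (suc (suc k)) (λ ()) (λ ())) ⟩
    0# + 0#
      ≈⟨ +-identityˡ 0# ⟩
    0# ∎
  sum-adjacent-cancel (suc j) f cancel others = begin
    f zero + sum (f ∘ suc)
      ≈⟨ +-cong (others zero (λ ()) (λ ()))
           (sum-adjacent-cancel j (f ∘ suc) cancel λ k p q →
             others (suc k) (p ∘ Finₚ.suc-injective) (q ∘ Finₚ.suc-injective)) ⟩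
    0# + 0#
      ≈⟨ +-identityˡ 0# ⟩
    0# ∎

  -- Deleting a column other than two adjacent ones leaves these two adjacent.
  punchIn-adjacent : ∀ {n} (j : Fin (suc n)) (k : Fin (suc (suc n))) →
    k ≢ inject₁ j → k ≢ suc j →
    ∃ λ j′ → punchIn k (inject₁ j′) ≡ inject₁ j × punchIn k (suc j′) ≡ suc j
  punchIn-adjacent zero    zero    p q = ⊥-elim (p refl)
  punchIn-adjacent (suc j) zero    p q = j , refl , refl
  punchIn-adjacent zero    (suc zero) p q = ⊥-elim (q refl)
  punchIn-adjacent {suc n} zero (suc (suc k)) p q = zero , refl , refl
  punchIn-adjacent {suc n} (suc j) (suc k) p q =
    let j′ , e , e′ = punchIn-adjacent j k (p ∘ cong suc) (q ∘ cong suc)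
    in  suc j′ , cong suc e , cong suc e′

  -- Deleting either one of two equal adjacent columns gives the same matrix.
  punchIn-either : ∀ {n} (j : Fin n) (v : Fin (suc n) → Carrier) →
    v (inject₁ j) ≈ v (suc j) → ∀ l → v (punchIn (inject₁ j) l) ≈ v (punchIn (suc j) l)
  punchIn-either zero    v e zero    = ≈-sym e
  punchIn-either zero    v e (suc l) = ≈-refl
  punchIn-either (suc j) v e zero    = ≈-refl
  punchIn-either (suc j) v e (suc l) = punchIn-either j (v ∘ suc) e l

  det-adjacent : ∀ {n} (j : Fin n) (M : Matrix (suc n)) →
    (∀ i → M i (inject₁ j) ≈ M i (suc j)) → det M ≈ 0#
  det-adjacent {suc n} j M equal = sum-adjacent-cancel j term cancel others
    where
    term : Fin (suc (suc n)) → Carrier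
    term k = (- 1#) ^ toℕ k * M zero k * det (minor M k)

    cancel : term (inject₁ j) + term (suc j) ≈ 0#
    cancel = begin
      (- 1#) ^ toℕ (inject₁ j) * M zero (inject₁ j) * det (minor M (inject₁ j)) + term (suc j)
        ≈⟨ +-congʳ (*-cong (*-cong (reflexive (cong ((- 1#) ^_) (Finₚ.toℕ-inject₁ j))) (equal zero))
             (det-cong λ i → punchIn-either j (M (suc i)) (equal (suc i)))) ⟩
      (- 1#) ^ toℕ j * M zero (suc j) * det (minor M (suc j)) + term (suc j)
        ≈⟨ solve 4 (λ u e m d → e :* m :* d :+ u :* e :* m :* d := e :* m :* d :+ u :* (e :* m :* d))
             ≈-refl (- 1#) ((- 1#) ^ toℕ j) (M zero (suc j)) (det (minor M (suc j))) ⟩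
      z + - 1# * z
        ≈⟨ +-congˡ (-1*x≈-x z) ⟩
      z + - z
        ≈⟨ -‿inverseʳ z ⟩
      0# ∎
      where z = (- 1#) ^ toℕ j * M zero (suc j) * det (minor M (suc j))

    others : ∀ k → k ≢ inject₁ j → k ≢ suc j → term k ≈ 0#
    others k p q = ≈-trans (*-congˡ (det-adjacent j′ (minor M k) λ i →
        subst₂ (λ a b → M (suc i) a ≈ M (suc i) b) (sym e) (sym e′) (equal (suc i))))
      (zeroʳ _)
      where
      j′ = proj₁ (punchIn-adjacent j k p q)
      e  = proj₁ (proj₂ (punchIn-adjacent j k p q))
      e′ = proj₂ (proj₂ (punchIn-adjacent j k p q))

-- Minors of rational matrices and bidiagonal column operations

module RationalMinors where
  open DeterminantProperties ℚₚ.+-*-commutativeRing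
    using (det-cong; det-linear; det-adjacent)
  open Determinant ℚₚ.+-*-rawRing using (det)
  open import Algebra.Definitions.RawSemiring ℚₚ.+-*-rawSemiring using (sum; _^_)

  0≤+ : ∀ {x y} → 0ℚ ℚ.≤ x → 0ℚ ℚ.≤ y → 0ℚ ℚ.≤ x ℚ.+ y
  0≤+ = ℚₚ.+-mono-≤

  0≤* : ∀ {x y} → 0ℚ ℚ.≤ x → 0ℚ ℚ.≤ y → 0ℚ ℚ.≤ x ℚ.* y
  0≤* {x} {y} 0≤x 0≤y = ℚₚ.nonNegative⁻¹ (x ℚ.* y)
    {{ℚₚ.nonNeg*nonNeg⇒nonNeg x {{ℚ.nonNegative 0≤x}} y {{ℚ.nonNegative 0≤y}}}}

  0≤sum : ∀ {n} {f : Fin n → ℚ} → (∀ i → 0ℚ ℚ.≤ f i) → 0ℚ ℚ.≤ sum f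
  0≤sum {zero}  0≤f = ℚₚ.≤-refl
  0≤sum {suc n} 0≤f = 0≤+ (0≤f zero) (0≤sum (0≤f ∘ suc))

  module _ {n : ℕ} where
    -- A matrix with n rows and m columns, given by its columns.
    Columns : ℕ → Set
    Columns m = Fin m → Fin n → ℚ

    -- With all columns but one held fixed, the admissible values of that column
    -- are closed under nonnegative combinations of two vectors.
    SeparatelyConic : ∀ {m} → (Columns m → Set) → Set
    SeparatelyConic Pos = ∀ j {C P Q} x y → 0ℚ ℚ.≤ x → 0ℚ ℚ.≤ y →
      (∀ i → C j i ≡ x ℚ.* P j i ℚ.+ y ℚ.* Q j i) →
      (∀ k → k ≢ j → ∀ i → C k i ≡ P k i) → (∀ k → k ≢ j → ∀ i → C k i ≡ Q k i) →
      Pos P → Pos Q → Pos C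

    -- If all 2 ^ m selections of a column P j or Q j for each j are admissible,
    -- then so is the family of mixed columns x j P j + y j Q j.  The first column is
    -- split by conicity, and the others by induction with that column fixed.
    all-combinations : ∀ {m} (Pos : Columns m → Set) →
      (∀ {C D} → (∀ j i → C j i ≡ D j i) → Pos C → Pos D) →
      SeparatelyConic Pos →
      (x y : Fin m → ℚ) → (∀ j → 0ℚ ℚ.≤ x j) → (∀ j → 0ℚ ℚ.≤ y j) →
      (P Q : Columns m) →
      (∀ (e : Fin m → Bool) → Pos (λ j → if e j then P j else Q j)) →
      Pos (λ j i → x j ℚ.* P j i ℚ.+ y j ℚ.* Q j i)
    all-combinations {zero}  Pos ext conic x y 0≤x 0≤y P Q pos = ext (λ ()) (pos (λ ()))
    all-combinations {suc m} Pos ext conic x y 0≤x 0≤y P Q pos =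
      ext {C = (λ i → x zero ℚ.* P zero i ℚ.+ y zero ℚ.* Q zero i) ∷ mixed}
        (λ { zero i → refl ; (suc j) i → refl })
        (conic zero (x zero) (y zero) (0≤x zero) (0≤y zero) (λ i → refl)
          off-zero off-zero (with-head true) (with-head false))
      where
      -- The mixed columns other than the first.
      mixed : Columns m
      mixed j i = x (suc j) ℚ.* P (suc j) i ℚ.+ y (suc j) ℚ.* Q (suc j) i

      off-zero : ∀ {v w : Fin n → ℚ} k → k ≢ zero → ∀ i → (v ∷ mixed) k i ≡ (w ∷ mixed) k i
      off-zero zero    k≢0 i = ⊥-elim (k≢0 refl)
      off-zero (suc k) k≢0 i = refl

      cons-cong : ∀ {v : Fin n → ℚ} {C D : Columns m} → (∀ j i → C j i ≡ D j i) →
        ∀ j i → (v ∷ C) j i ≡ (v ∷ D) j i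
      cons-cong C≡D zero    i = refl
      cons-cong C≡D (suc j) i = C≡D j i

      with-head : ∀ b → Pos ((if b then P zero else Q zero) ∷ mixed)
      with-head b = all-combinations (λ C → Pos (v ∷ C)) (ext ∘ cons-cong)
        (λ { j {C} {C₁} {C₂} x y 0≤x 0≤y at off₁ off₂ →
             conic (suc j) {v ∷ C} {v ∷ C₁} {v ∷ C₂} x y 0≤x 0≤y at (lift off₁) (lift off₂) })
        (x ∘ suc) (y ∘ suc) (0≤x ∘ suc) (0≤y ∘ suc) (P ∘ suc) (Q ∘ suc)
        λ e → ext (λ { zero i → refl ; (suc j) i → refl }) (pos (b ∷ e))
        where
        v = if b then P zero else Q zero
        lift : ∀ {j} {C D : Columns m} → (∀ k → k ≢ j → ∀ i → C k i ≡ D k i) →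
          ∀ k → k ≢ suc j → ∀ i → (v ∷ C) k i ≡ (v ∷ D) k i
        lift off zero    k≢j i = refl
        lift off (suc k) k≢j i = off k (k≢j ∘ cong suc) i

  det-conic : ∀ {m} → SeparatelyConic {m} {m} (λ C → 0ℚ ℚ.≤ det (λ i j → C j i))
  det-conic j x y 0≤x 0≤y at off₁ off₂ 0≤P 0≤Q =
    subst (0ℚ ℚ.≤_)
      (sym (det-linear j x y at (λ i k k≢j → off₁ k k≢j i) (λ i k k≢j → off₂ k k≢j i)))
      (0≤+ (0≤* 0≤x 0≤P) (0≤* 0≤y 0≤Q))

  -- The maximal minors of a matrix with m rows and infinitely many columns
  -- are nonnegative.
  NonnegMinors : ∀ {m} → (Fin m → ℕ → ℚ) → Set
  NonnegMinors {m} X = ∀ (cols : Fin m → ℕ) → Increasing cols →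
    0ℚ ℚ.≤ det (λ i j → X i (cols j))

  -- Weakly increasing column indices: repetitions only add vanishing minors.
  weak-minor : ∀ {m} {X : Fin m → ℕ → ℚ} → NonnegMinors X →
    (f : Fin m → ℕ) → (∀ {i j} → i Fin.< j → f i ℕ.≤ f j) →
    0ℚ ℚ.≤ det (λ i j → X i (f j))
  weak-minor {zero}  minors f mono = minors f λ { {()} }
  weak-minor {suc m} {X} minors f mono
    with Finₚ.any? (λ j → f (inject₁ j) ℕₚ.≟ f (suc j))
  ... | yes (j , e) = ℚₚ.≤-reflexive (sym (det-adjacent j (λ i k → X i (f k)) λ i → cong (X i) e))
  ... | no distinct = minors f increasing
    where
    step : ∀ j → f (inject₁ j) ℕ.< f (suc j)
    step j = ℕₚ.≤∧≢⇒< (mono (s≤s (ℕₚ.≤-reflexive (Finₚ.toℕ-inject₁ j))))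
                      (λ e → distinct (j , e))
    increasing : Increasing f
    increasing {i} {suc j} (s≤s i≤j)
      with ℕₚ.m≤n⇒m<n∨m≡n (subst (toℕ i ℕ.≤_) (sym (Finₚ.toℕ-inject₁ j)) i≤j)
    ... | inj₁ i<j = ℕₚ.≤-<-trans (mono i<j) (step j)
    ... | inj₂ i≡j = subst (λ k → f k ℕ.< f (suc j)) (sym (Finₚ.toℕ-injective i≡j)) (step j)

  -- Column k is replaced by a nonnegative combination of two columns picked near
  -- k.  By the interlacing hypothesis, every choice of one of the two columns for
  -- each member of an increasing family gives weakly increasing indices.
  bidiagonal-minors : ∀ {m} {X : Fin m → ℕ → ℚ} (pick : Bool → ℕ → ℕ) →
    (∀ e e′ {k k′} → k ℕ.< k′ → pick e k ℕ.≤ pick e′ k′) →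
    (x y : ℕ → ℚ) → (∀ k → 0ℚ ℚ.≤ x k) → (∀ k → 0ℚ ℚ.≤ y k) →
    NonnegMinors X →
    NonnegMinors (λ i k → x k ℚ.* X i (pick true k) ℚ.+ y k ℚ.* X i (pick false k))
  bidiagonal-minors {X = X} pick interlace x y 0≤x 0≤y minors cols inc =
    all-combinations (λ C → 0ℚ ℚ.≤ det (λ i j → C j i))
      (λ C≡D → subst (0ℚ ℚ.≤_) (det-cong λ i j → C≡D j i)) det-conic
      (x ∘ cols) (y ∘ cols) (0≤x ∘ cols) (0≤y ∘ cols)
      (λ j i → X i (pick true (cols j))) (λ j i → X i (pick false (cols j)))
      λ e → subst (0ℚ ℚ.≤_) (det-cong λ i j → choose (e j) i j)
        (weak-minor {X = X} minors (λ j → pick (e j) (cols j)) λ i<j → interlace _ _ (inc i<j))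
    where
    choose : ∀ b i j → X i (pick b (cols j)) ≡
      (if b then (λ i → X i (pick true (cols j))) else (λ i → X i (pick false (cols j)))) i
    choose true  i j = refl
    choose false i j = refl

-- Total positivity from a bidiagonal factorization

  -- The two columns combined by a lower, respectively upper, bidiagonal factor.
  -- The predecessor of column 0 is column 0 itself.
  stay-or-next stay-or-previous : Bool → ℕ → ℕ
  stay-or-next     b k = if b then k else suc k
  stay-or-previous b k = if b then k else ℕ.pred k

  next-interlaces : ∀ e e′ {k k′} → k ℕ.< k′ → stay-or-next e k ℕ.≤ stay-or-next e′ k′
  next-interlaces true  true  k<k′ = ℕₚ.<⇒≤ k<k′
  next-interlaces true  false k<k′ = ℕₚ.m≤n⇒m≤1+n (ℕₚ.<⇒≤ k<k′)
  next-interlaces false true  k<k′ = k<k′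
  next-interlaces false false k<k′ = ℕₚ.m≤n⇒m≤1+n k<k′

  previous-interlaces : ∀ e e′ {k k′} → k ℕ.< k′ →
    stay-or-previous e k ℕ.≤ stay-or-previous e′ k′
  previous-interlaces true  true  k<k′ = ℕₚ.<⇒≤ k<k′
  previous-interlaces true  false (s≤s k≤k′) = k≤k′
  previous-interlaces false true  k<k′ = ℕₚ.≤-trans ℕₚ.pred[n]≤n (ℕₚ.<⇒≤ k<k′)
  previous-interlaces false false k<k′ = ℕₚ.pred-mono-≤ (ℕₚ.<⇒≤ k<k′)

  -- All minors of a rational matrix are nonnegative.
  TotallyPositive : (ℕ → ℕ → ℚ) → Set
  TotallyPositive a = ∀ {m} (rows : Fin m → ℕ) → Increasing rows →
    NonnegMinors (a ∘ rows)

  -- Laplace expansion along a first row that vanishes off the corner.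
  det-corner-row : ∀ {m} (M : Fin (suc m) → Fin (suc m) → ℚ) →
    0ℚ ℚ.≤ M zero zero → (∀ j → M zero (suc j) ≡ 0ℚ) →
    0ℚ ℚ.≤ det (λ i j → M (suc i) (suc j)) → 0ℚ ℚ.≤ det M
  det-corner-row M 0≤M₀₀ M₀₊ 0≤minor = 0≤+
    (0≤* (0≤* {1ℚ} (ℚₚ.nonNegative⁻¹ 1ℚ) 0≤M₀₀) 0≤minor)
    (0≤sum λ j → ℚₚ.≤-reflexive (sym (vanish ((ℚ.- 1ℚ) ^ toℕ (suc j)) _ (M₀₊ j))))
    where
    vanish : ∀ x y {z} → z ≡ 0ℚ → x ℚ.* z ℚ.* y ≡ 0ℚ
    vanish x y refl = trans (cong (ℚ._* y) (ℚₚ.*-zeroʳ x)) (ℚₚ.*-zeroˡ y)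

  bounded : ∀ {m} (f : Fin m → ℕ) → ∃ λ N → ∀ i → f i ℕ.< N
  bounded {zero}  f = 0 , λ ()
  bounded {suc m} f with bounded (f ∘ suc)
  ... | N , f<N = suc (f zero) ℕ.⊔ N , λ
    { zero    → ℕₚ.m≤m⊔n (suc (f zero)) N
    ; (suc i) → ℕₚ.<-≤-trans (f<N i) (ℕₚ.m≤n⊔m (suc (f zero)) N) }

  -- The product of b and the lower bidiagonal matrix with diagonal p, whose
  -- entry in row k + 1 and column k is l k.
  times-lower : (p l : ℕ → ℚ) → (ℕ → ℕ → ℚ) → ℕ → ℕ → ℚ
  times-lower p l b n k = p k ℚ.* b n k ℚ.+ l k ℚ.* b n (suc k)

  -- The product of b and the upper bidiagonal matrix with diagonal q, whose
  -- entry in row k - 1 and column k is u k.  In column 0 there is no such entry,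
  -- and u 0 is meant to be 0; another value adds to the diagonal entry.
  times-upper : (q u : ℕ → ℚ) → (ℕ → ℕ → ℚ) → ℕ → ℕ → ℚ
  times-upper q u b n k = q k ℚ.* b n k ℚ.+ u k ℚ.* b n (ℕ.pred k)

  module _ (a : ℕ → ℕ → ℚ) (0≤a₀₀ : 0ℚ ℚ.≤ a 0 0) (a₀₊ : ∀ k → a 0 (suc k) ≡ 0ℚ)
    (p l q u : ℕ → ℚ)
    (0≤p : ∀ k → 0ℚ ℚ.≤ p k) (0≤l : ∀ k → 0ℚ ℚ.≤ l k)
    (0≤q : ∀ k → 0ℚ ℚ.≤ q k) (0≤u : ∀ k → 0ℚ ℚ.≤ u k)
    (production : ∀ n k → a (suc n) k ≡ times-upper q u (times-lower p l a) n k)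
    where

    -- The minors of a with all row indices below N are nonnegative.
    MinorsBelow : ℕ → Set
    MinorsBelow N = ∀ {m} (rows : Fin m → ℕ) → (∀ i → rows i ℕ.< N) →
      Increasing rows → NonnegMinors (a ∘ rows)

    -- Rows with positive indices are rows of the product, one index lower.
    shifted-minors : ∀ {N} → MinorsBelow N → ∀ {m} (rows : Fin m → ℕ) →
      (∀ i → 0 ℕ.< rows i) → (∀ i → rows i ℕ.< suc N) →
      Increasing rows → NonnegMinors (a ∘ rows)
    shifted-minors below rows 0<rows rows<N inc cols cols-inc =
      subst (0ℚ ℚ.≤_) (det-cong λ i j → entry i (cols j))
        (bidiagonal-minors {X = times-lower p l a ∘ rows⁻} stay-or-previous previous-interlaces q u 0≤q 0≤u
          (bidiagonal-minors {X = a ∘ rows⁻} stay-or-next next-interlaces p l 0≤p 0≤l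
            (below rows⁻ rows⁻<N rows⁻-inc))
          cols cols-inc)
      where
      rows⁻ : _ → ℕ
      rows⁻ i = ℕ.pred (rows i)
      suc-rows⁻ : ∀ i → suc (rows⁻ i) ≡ rows i
      suc-rows⁻ i = ℕₚ.suc-pred (rows i) {{ℕ.>-nonZero (0<rows i)}}
      rows⁻<N : ∀ i → rows⁻ i ℕ.< _
      rows⁻<N i = ℕ.s≤s⁻¹ (subst (ℕ._< _) (sym (suc-rows⁻ i)) (rows<N i))
      rows⁻-inc : Increasing rows⁻
      rows⁻-inc {i} {j} i<j = ℕ.s≤s⁻¹
        (subst₂ ℕ._<_ (sym (suc-rows⁻ i)) (sym (suc-rows⁻ j)) (inc i<j))
      entry : ∀ i k → times-upper q u (times-lower p l a) (rows⁻ i) k ≡ a (rows i) k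
      entry i k = trans (sym (production (rows⁻ i) k)) (cong (λ n → a n k) (suc-rows⁻ i))

    0≤a₀ : ∀ k → 0ℚ ℚ.≤ a 0 k
    0≤a₀ zero    = 0≤a₀₀
    0≤a₀ (suc k) = ℚₚ.≤-reflexive (sym (a₀₊ k))

    a₀-positive-column : ∀ {k} → 0 ℕ.< k → a 0 k ≡ 0ℚ
    a₀-positive-column {suc k} _ = a₀₊ k

    minors-below : ∀ N → MinorsBelow N
    minors-below N {zero} rows _ _ cols _ = ℚₚ.nonNegative⁻¹ 1ℚ
    minors-below zero {suc m} rows rows<0 = ⊥-elim (ℕₚ.n≮0 (rows<0 zero))
    minors-below (suc N) {suc m} rows rows<N inc cols cols-inc
      with ℕₚ.m≤n⇒m<n∨m≡n (z≤n {rows zero})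
    ... | inj₁ 0<rows₀ =
      shifted-minors (minors-below N) rows positive rows<N inc cols cols-inc
      where
      positive : ∀ i → 0 ℕ.< rows i
      positive zero    = 0<rows₀
      positive (suc i) = ℕₚ.<-trans 0<rows₀ (inc (s≤s z≤n))
    ... | inj₂ 0≡rows₀ = det-corner-row (λ i j → a (rows i) (cols j))
      (subst (0ℚ ℚ.≤_) (sym (top-row zero)) (0≤a₀ (cols zero)))
      (λ j → trans (top-row (suc j))
        (a₀-positive-column (ℕₚ.≤-<-trans z≤n (cols-inc {zero} {suc j} (s≤s z≤n)))))
      (shifted-minors (minors-below N) (rows ∘ suc)
        (λ i → ℕₚ.≤-<-trans z≤n (inc {zero} {suc i} (s≤s z≤n)))
        (rows<N ∘ suc) (inc ∘ s≤s) (cols ∘ suc) (cols-inc ∘ s≤s))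
      where
      top-row : ∀ j → a (rows zero) (cols j) ≡ a 0 (cols j)
      top-row j = cong (λ n → a n (cols j)) (sym 0≡rows₀)

    factorization⇒TP : TotallyPositive a
    factorization⇒TP rows = let N , rows<N = bounded rows in minors-below N rows rows<N

-- Diagonal dominance and pivots

  -- For d = 0 also x = 0, and c = 0 serves as the quotient x / d.
  bounded-quotient : ∀ {x d} → 0ℚ ℚ.≤ x → x ℚ.≤ d →
    ∃ λ c → 0ℚ ℚ.≤ c × c ℚ.≤ 1ℚ × d ℚ.* c ≡ x
  bounded-quotient {x} {d} 0≤x x≤d with d ℚₚ.≟ 0ℚ
  ... | yes refl = 0ℚ , ℚₚ.≤-refl , ℚₚ.nonNegative⁻¹ 1ℚ , ℚₚ.≤-antisym 0≤x x≤d
  ... | no d≢0 = 1/d ℚ.* x , 0≤* 0≤1/d 0≤x , quotient≤1 , d*quotient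
    where
    instance
      d-positive : ℚ.Positive d
      d-positive = ℚ.positive (ℚₚ.≰⇒> λ d≤0 → d≢0 (ℚₚ.≤-antisym d≤0 (ℚₚ.≤-trans 0≤x x≤d)))
      d-nonZero : ℚ.NonZero d
      d-nonZero = ℚₚ.pos⇒nonZero d
    1/d : ℚ
    1/d = ℚ.1/ d
    0≤1/d : 0ℚ ℚ.≤ 1/d
    0≤1/d = ℚₚ.<⇒≤ (ℚₚ.positive⁻¹ 1/d {{ℚₚ.1/pos⇒pos d}})
    quotient≤1 : 1/d ℚ.* x ℚ.≤ 1ℚ
    quotient≤1 = subst (1/d ℚ.* x ℚ.≤_) (ℚₚ.*-inverseˡ d)
      (ℚₚ.*-monoˡ-≤-nonNeg 1/d {{ℚ.nonNegative 0≤1/d}} x≤d)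
    d*quotient : d ℚ.* (1/d ℚ.* x) ≡ x
    d*quotient = trans (sym (ℚₚ.*-assoc d 1/d x))
      (trans (cong (ℚ._* x) (ℚₚ.*-inverseʳ d)) (ℚₚ.*-identityˡ x))

  -- Pivots d and multipliers c of the tridiagonal matrix with diagonal s, where x
  -- and y are the off-diagonal sequences, in either order: d k * c k = x k, and
  -- d (k + 1) + y k * c k = s (k + 1).
  module Pivots (x y s : ℕ → ℚ)
    (0≤x : ∀ k → 0ℚ ℚ.≤ x k) (0≤y : ∀ k → 0ℚ ℚ.≤ y k)
    (x₀≤s₀ : x 0 ℚ.≤ s 0) (dominant : ∀ k → x (suc k) ℚ.+ y k ℚ.≤ s (suc k))
    where

    d c : ℕ → ℚ
    x≤d : ∀ k → x k ℚ.≤ d k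
    quotient : ∀ k → ∃ λ c → 0ℚ ℚ.≤ c × c ℚ.≤ 1ℚ × d k ℚ.* c ≡ x k

    d zero    = s 0
    d (suc k) = s (suc k) ℚ.- y k ℚ.* c k
    c k = proj₁ (quotient k)
    quotient k = bounded-quotient (0≤x k) (x≤d k)
    x≤d zero    = x₀≤s₀
    x≤d (suc k) = begin
      x (suc k)
        ≡⟨ solve 2 (λ x w → x := (x :+ w) :- w) refl (x (suc k)) (y k) ⟩
      x (suc k) ℚ.+ y k ℚ.- y k
        ≤⟨ ℚₚ.+-mono-≤ (dominant k) (ℚₚ.neg-antimono-≤ yc≤y) ⟩
      s (suc k) ℚ.- y k ℚ.* c k ∎
      where
      open ℚₚ.≤-Reasoning
      open +-*-Solver
      yc≤y : y k ℚ.* c k ℚ.≤ y k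
      yc≤y = subst (y k ℚ.* c k ℚ.≤_) (ℚₚ.*-identityʳ (y k))
        (ℚₚ.*-monoˡ-≤-nonNeg (y k) {{ℚ.nonNegative (0≤y k)}}
          (proj₁ (proj₂ (proj₂ (quotient k)))))

    0≤c : ∀ k → 0ℚ ℚ.≤ c k
    0≤c k = proj₁ (proj₂ (quotient k))

    dc≡x : ∀ k → d k ℚ.* c k ≡ x k
    dc≡x k = proj₂ (proj₂ (proj₂ (quotient k)))

    0≤d : ∀ k → 0ℚ ℚ.≤ d k
    0≤d k = ℚₚ.≤-trans (0≤x k) (x≤d k)

  -- A rational matrix a that satisfies the recurrence; r 0 and t 0 are not used.
  module _ (r s t : ℕ → ℚ)
    (0≤r : ∀ k → 0ℚ ℚ.≤ r (suc k)) (0≤t : ∀ k → 0ℚ ℚ.≤ t (suc k))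
    (a : ℕ → ℕ → ℚ) (a₀₀ : a 0 0 ≡ 1ℚ) (a₀₊ : ∀ k → a 0 (suc k) ≡ 0ℚ)
    (first-column : ∀ n → a (suc n) 0 ≡ s 0 ℚ.* a n 0 ℚ.+ t 1 ℚ.* a n 1)
    (later-columns : ∀ n k → a (suc n) (suc k) ≡
      r (suc k) ℚ.* a n k ℚ.+ s (suc k) ℚ.* a n (suc k) ℚ.+ t (2 ℕ.+ k) ℚ.* a n (2 ℕ.+ k))
    where
    open +-*-Solver

    0≤a₀₀ : 0ℚ ℚ.≤ a 0 0
    0≤a₀₀ = subst (0ℚ ℚ.≤_) (sym a₀₀) (ℚₚ.nonNegative⁻¹ 1ℚ)

    0≤1 : ℕ → 0ℚ ℚ.≤ 1ℚ
    0≤1 _ = ℚₚ.nonNegative⁻¹ 1ℚ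

    -- The superdiagonal, indexed by columns.
    prepend-0 : (ℕ → ℚ) → ℕ → ℚ
    prepend-0 f zero    = 0ℚ
    prepend-0 f (suc k) = f k

    0≤prepend-0 : ∀ {f} → (∀ k → 0ℚ ℚ.≤ f k) → ∀ k → 0ℚ ℚ.≤ prepend-0 f k
    0≤prepend-0 0≤f zero    = ℚₚ.≤-refl
    0≤prepend-0 0≤f (suc k) = 0≤f k

    -- L has diagonal d and subdiagonal t; U has diagonal 1 and superdiagonal c.
    row-dominant⇒TP : r 1 ℚ.≤ s 0 → (∀ k → r (2 ℕ.+ k) ℚ.+ t (suc k) ℚ.≤ s (suc k)) →
      TotallyPositive a
    row-dominant⇒TP r₁≤s₀ dominant = factorization⇒TP a 0≤a₀₀ a₀₊
      d (t ∘ suc) (λ _ → 1ℚ) (prepend-0 c) 0≤d 0≤t 0≤1 (0≤prepend-0 0≤c) production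
      where
      open Pivots (r ∘ suc) (t ∘ suc) s 0≤r 0≤t r₁≤s₀ dominant
      product : ∀ s y z {d c x} α β γ → d ℚ.* c ≡ x →
        x ℚ.* α ℚ.+ s ℚ.* β ℚ.+ z ℚ.* γ ≡
        1ℚ ℚ.* ((s ℚ.- y ℚ.* c) ℚ.* β ℚ.+ z ℚ.* γ) ℚ.+ c ℚ.* (d ℚ.* α ℚ.+ y ℚ.* β)
      product s y z {d} {c} α β γ refl = solve 8 (λ s y z d c α β γ →
          d :* c :* α :+ s :* β :+ z :* γ :=
          con 1ℚ :* ((s :- y :* c) :* β :+ z :* γ) :+ c :* (d :* α :+ y :* β))
        refl s y z d c α β γ
      production : ∀ n k → a (suc n) k ≡
        times-upper (λ _ → 1ℚ) (prepend-0 c) (times-lower d (t ∘ suc) a) n k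
      production n zero = trans (first-column n)
        (solve 1 (λ v → v := con 1ℚ :* v :+ con 0ℚ :* v) refl _)
      production n (suc k) = trans (later-columns n k)
        (product (s (suc k)) (t (suc k)) (t (2 ℕ.+ k)) {d k} (a n k) (a n (suc k)) (a n (2 ℕ.+ k)) (dc≡x k))

    -- L has diagonal 1 and subdiagonal c; U has diagonal d and superdiagonal r.
    column-dominant⇒TP : t 1 ℚ.≤ s 0 → (∀ k → t (2 ℕ.+ k) ℚ.+ r (suc k) ℚ.≤ s (suc k)) →
      TotallyPositive a
    column-dominant⇒TP t₁≤s₀ dominant = factorization⇒TP a 0≤a₀₀ a₀₊
      (λ _ → 1ℚ) c d (prepend-0 (r ∘ suc)) 0≤1 0≤c 0≤d (0≤prepend-0 0≤r) production
      where
      open Pivots (t ∘ suc) (r ∘ suc) s 0≤t 0≤r t₁≤s₀ dominant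
      product₀ : ∀ s {c z} α β → s ℚ.* c ≡ z →
        s ℚ.* α ℚ.+ z ℚ.* β ≡
        s ℚ.* (1ℚ ℚ.* α ℚ.+ c ℚ.* β) ℚ.+ 0ℚ ℚ.* (1ℚ ℚ.* α ℚ.+ c ℚ.* β)
      product₀ s {c} α β refl = solve 4 (λ s c α β →
          s :* α :+ s :* c :* β :=
          s :* (con 1ℚ :* α :+ c :* β) :+ con 0ℚ :* (con 1ℚ :* α :+ c :* β))
        refl s c α β
      product : ∀ s y c {c′ z} α β γ → (s ℚ.- y ℚ.* c) ℚ.* c′ ≡ z →
        y ℚ.* α ℚ.+ s ℚ.* β ℚ.+ z ℚ.* γ ≡
        (s ℚ.- y ℚ.* c) ℚ.* (1ℚ ℚ.* β ℚ.+ c′ ℚ.* γ) ℚ.+ y ℚ.* (1ℚ ℚ.* α ℚ.+ c ℚ.* β)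
      product s y c {c′} α β γ refl = solve 7 (λ s y c c′ α β γ →
          y :* α :+ s :* β :+ (s :- y :* c) :* c′ :* γ :=
          (s :- y :* c) :* (con 1ℚ :* β :+ c′ :* γ) :+ y :* (con 1ℚ :* α :+ c :* β))
        refl s y c c′ α β γ
      production : ∀ n k → a (suc n) k ≡
        times-upper d (prepend-0 (r ∘ suc)) (times-lower (λ _ → 1ℚ) c a) n k
      production n zero = trans (first-column n)
        (product₀ (s 0) (a n 0) (a n 1) (dc≡x 0))
      production n (suc k) = trans (later-columns n k)
        (product (s (suc k)) (r (suc k)) (c k) (a n k) (a n (suc k)) (a n (2 ℕ.+ k)) (dc≡x (suc k)))

-- Congruence of the operations on real numbers

open import Defs

module RealApproximation where
  open CauchyLemmas
  open Determinant ℚₚ.+-*-rawRing renaming (det to detℚ) using ()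

  ≈-refl : ∀ {x} → x ≈ x
  ≈-refl {x} ε 0<ε = 0 , λ n _ → subst (ℚ._< ε) (sym (∣p-p∣≡0 (seq x n))) 0<ε

  +-cong : ∀ {x x′ y y′} → x ≈ x′ → y ≈ y′ → x + y ≈ x′ + y′
  +-cong {x} {x′} {y} {y′} x≈x′ y≈y′ ε 0<ε
    with x≈x′ (ε ℚ.* ½) (half-pos 0<ε) | y≈y′ (ε ℚ.* ½) (half-pos 0<ε)
  ... | M , p | N , q = M ℕ.⊔ N , λ n h → begin-strict
      ℚ.∣ (seq x n ℚ.+ seq y n) ℚ.- (seq x′ n ℚ.+ seq y′ n) ∣
    ≡⟨ cong ℚ.∣_∣ (solve 4 (λ a b c d → (a :+ b) :- (c :+ d) := (a :- c) :+ (b :- d)) refl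
         (seq x n) (seq y n) (seq x′ n) (seq y′ n)) ⟩
      ℚ.∣ (seq x n ℚ.- seq x′ n) ℚ.+ (seq y n ℚ.- seq y′ n) ∣
    ≤⟨ ℚₚ.∣p+q∣≤∣p∣+∣q∣ (seq x n ℚ.- seq x′ n) (seq y n ℚ.- seq y′ n) ⟩
      ℚ.∣ seq x n ℚ.- seq x′ n ∣ ℚ.+ ℚ.∣ seq y n ℚ.- seq y′ n ∣
    <⟨ ℚₚ.+-mono-< (p n (ℕₚ.m⊔n≤o⇒m≤o M N h)) (q n (ℕₚ.m⊔n≤o⇒n≤o M N h)) ⟩
      ε ℚ.* ½ ℚ.+ ε ℚ.* ½
    ≡⟨ halves ε ⟩
      ε ∎
    where
    open ℚₚ.≤-Reasoning
    open +-*-Solver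

  *-cong : ∀ {x x′ y y′} → x ≈ x′ → y ≈ y′ → x * y ≈ x′ * y′
  *-cong {x} {x′} {y} {y′} x≈x′ y≈y′ ε 0<ε =
    let A , 0<A , K , x≤A  = bounded (cauchy x)
        B , 0<B , L , y′≤B = bounded (cauchy y′)
        α , 0<α , Aα       = divide {A} 0<A (half-pos 0<ε)
        β , 0<β , Bβ       = divide {B} 0<B (half-pos 0<ε)
        M , p              = x≈x′ β 0<β
        N , q              = y≈y′ α 0<α
    in (K ℕ.⊔ L) ℕ.⊔ (M ℕ.⊔ N) , λ n h →
    let hKL = ℕₚ.m⊔n≤o⇒m≤o (K ℕ.⊔ L) (M ℕ.⊔ N) h
        hMN = ℕₚ.m⊔n≤o⇒n≤o (K ℕ.⊔ L) (M ℕ.⊔ N) h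
    in subst (ℚ.∣ seq x n ℚ.* seq y n ℚ.- seq x′ n ℚ.* seq y′ n ∣ ℚ.<_)
         (trans (cong₂ ℚ._+_ Aα Bβ) (halves ε))
         (*-diff-bound {seq x n} {seq y n} {seq x′ n} {seq y′ n} {A} {B} {α} {β} 0<A 0<B
           (x≤A n (ℕₚ.m⊔n≤o⇒m≤o K L hKL)) (y′≤B n (ℕₚ.m⊔n≤o⇒n≤o K L hKL))
           (q n (ℕₚ.m⊔n≤o⇒n≤o M N hMN)) (p n (ℕₚ.m⊔n≤o⇒m≤o M N hMN)))

  det-cong : ∀ {n} {M N : Fin n → Fin n → ℝ} → (∀ i j → M i j ≈ N i j) → det M ≈ det N
  det-cong = DeterminantRelation.det-related ℝ-rawRing ℝ-rawRing _≈_
    (≈-refl {0ℝ}) (≈-refl {1ℝ}) (≈-refl { - 1ℝ})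
    (λ {x} {x′} {y} {y′} → +-cong {x} {x′} {y} {y′})
    (λ {x} {x′} {y} {y′} → *-cong {x} {x′} {y} {y′})

  recMatrix-cong : ∀ {r r′ s s′ t t′} →
    (∀ k → r (suc k) ≈ r′ (suc k)) → (∀ k → s k ≈ s′ k) → (∀ k → t (suc k) ≈ t′ (suc k)) →
    ∀ n k → recMatrix r s t n k ≈ recMatrix r′ s′ t′ n k
  recMatrix-cong {r} {r′} {s} {s′} {t} {t′} r≈ s≈ t≈ = entry
    where
    a = recMatrix r s t
    b = recMatrix r′ s′ t′
    entry : ∀ n k → a n k ≈ b n k
    entry zero zero    = ≈-refl {1ℝ}
    entry zero (suc k) = ≈-refl {0ℝ}
    entry (suc n) zero =
      +-cong {s 0 * a n 0} {s′ 0 * b n 0} {t 1 * a n 1} {t′ 1 * b n 1}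
        (*-cong {s 0} {s′ 0} {a n 0} {b n 0} (s≈ 0) (entry n 0))
        (*-cong {t 1} {t′ 1} {a n 1} {b n 1} (t≈ 0) (entry n 1))
    entry (suc n) (suc k) =
      +-cong {r k₁ * a n k + s k₁ * a n k₁} {r′ k₁ * b n k + s′ k₁ * b n k₁}
             {t k₂ * a n k₂} {t′ k₂ * b n k₂}
        (+-cong {r k₁ * a n k} {r′ k₁ * b n k} {s k₁ * a n k₁} {s′ k₁ * b n k₁}
          (*-cong {r k₁} {r′ k₁} {a n k} {b n k} (r≈ k) (entry n k))
          (*-cong {s k₁} {s′ k₁} {a n k₁} {b n k₁} (s≈ k₁) (entry n k₁)))
        (*-cong {t k₂} {t′ k₂} {a n k₂} {b n k₂} (t≈ k₁) (entry n k₂))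
      where
      k₁ = suc k
      k₂ = suc (suc k)

  -- Operations on reals are termwise, and so is the determinant.
  seq-det : ∀ {n} (M : Fin n → Fin n → ℝ) i →
    seq (det M) i ≡ detℚ (λ j k → seq (M j k) i)
  seq-det M i = DeterminantRelation.det-related ℝ-rawRing ℚₚ.+-*-rawRing
    (λ x q → seq x i ≡ q) refl refl refl (cong₂ ℚ._+_) (cong₂ ℚ._*_)
    {M = M} (λ _ _ → refl)

-- Maxima and inequalities of real numbers

  close⇒< : ∀ {p q ε} → ℚ.∣ p ℚ.- q ∣ ℚ.< ε → p ℚ.< q ℚ.+ ε
  close⇒< {p} {q} {ε} close = begin-strict
    p                        ≡⟨ solve 2 (λ p q → p := q :+ (p :- q)) refl p q ⟩
    q ℚ.+ (p ℚ.- q)          ≤⟨ ℚₚ.+-monoʳ-≤ q (p≤∣p∣ (p ℚ.- q)) ⟩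
    q ℚ.+ ℚ.∣ p ℚ.- q ∣      <⟨ ℚₚ.+-monoʳ-< q close ⟩
    q ℚ.+ ε                  ∎
    where
    open ℚₚ.≤-Reasoning
    open +-*-Solver
    p≤∣p∣ : ∀ p → p ℚ.≤ ℚ.∣ p ∣
    p≤∣p∣ p with ℚₚ.≤-total 0ℚ p
    ... | inj₁ 0≤p = ℚₚ.≤-reflexive (sym (ℚₚ.0≤p⇒∣p∣≡p 0≤p))
    ... | inj₂ p≤0 = ℚₚ.≤-trans p≤0 (ℚₚ.0≤∣p∣ p)

  ∣p-q∣-comm : ∀ p q → ℚ.∣ p ℚ.- q ∣ ≡ ℚ.∣ q ℚ.- p ∣
  ∣p-q∣-comm p q = trans
    (cong ℚ.∣_∣ (solve 2 (λ p q → p :- q := :- (q :- p)) refl p q))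
    (ℚₚ.∣-p∣≡∣p∣ (q ℚ.- p))
    where open +-*-Solver

  <⇒close : ∀ {p q ε} → p ℚ.< q ℚ.+ ε → q ℚ.< p ℚ.+ ε → ℚ.∣ p ℚ.- q ∣ ℚ.< ε
  <⇒close {p} {q} {ε} p<q+ε q<p+ε with ℚₚ.∣p∣≡p∨∣p∣≡-p (p ℚ.- q)
  ... | inj₁ e = subst (ℚ._< ε) (sym e) (difference p<q+ε)
    where
    difference : ∀ {p q} → p ℚ.< q ℚ.+ ε → p ℚ.- q ℚ.< ε
    difference {p} {q} p<q+ε = subst (p ℚ.- q ℚ.<_)
      (solve 2 (λ q ε → q :+ ε :- q := ε) refl q ε) (ℚₚ.+-monoˡ-< (ℚ.- q) p<q+ε)
      where open +-*-Solver
  ... | inj₂ e = subst (ℚ._< ε) (sym e)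
      (subst₂ ℚ._<_ (solve 2 (λ p q → q :- p := :- (p :- q)) refl p q)
        (solve 2 (λ p ε → p :+ ε :- p := ε) refl p ε) (ℚₚ.+-monoˡ-< (ℚ.- p) q<p+ε))
    where open +-*-Solver

  p<p+ε : ∀ {p ε} → 0ℚ ℚ.< ε → p ℚ.< p ℚ.+ ε
  p<p+ε {p} {ε} 0<ε = subst (ℚ._< p ℚ.+ ε) (ℚₚ.+-identityʳ p) (ℚₚ.+-monoʳ-< p 0<ε)

  ⊔-lub-< : ∀ {p q o} → p ℚ.< o → q ℚ.< o → p ℚ.⊔ q ℚ.< o
  ⊔-lub-< {p} {q} p<o q<o with ℚₚ.⊔-sel p q
  ... | inj₁ e = subst (ℚ._< _) (sym e) p<o
  ... | inj₂ e = subst (ℚ._< _) (sym e) q<o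

  ⊔-close : ∀ {p q p′ q′ ε} → ℚ.∣ p ℚ.- p′ ∣ ℚ.< ε → ℚ.∣ q ℚ.- q′ ∣ ℚ.< ε →
    ℚ.∣ (p ℚ.⊔ q) ℚ.- (p′ ℚ.⊔ q′) ∣ ℚ.< ε
  ⊔-close {p} {q} {p′} {q′} {ε} pp′ qq′ = <⇒close (half {p} {q} {p′} {q′} pp′ qq′)
    (half {p′} {q′} {p} {q}
      (subst (ℚ._< ε) (∣p-q∣-comm p p′) pp′) (subst (ℚ._< ε) (∣p-q∣-comm q q′) qq′))
    where
    half : ∀ {p q p′ q′} → ℚ.∣ p ℚ.- p′ ∣ ℚ.< ε → ℚ.∣ q ℚ.- q′ ∣ ℚ.< ε →
      p ℚ.⊔ q ℚ.< (p′ ℚ.⊔ q′) ℚ.+ ε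
    half {p} {q} {p′} {q′} pp′ qq′ = ⊔-lub-<
      (ℚₚ.<-≤-trans (close⇒< {p} {p′} pp′) (ℚₚ.+-monoˡ-≤ ε (ℚₚ.p≤p⊔q p′ q′)))
      (ℚₚ.<-≤-trans (close⇒< {q} {q′} qq′) (ℚₚ.+-monoˡ-≤ ε (ℚₚ.p≤q⊔p p′ q′)))

  -- The maximum of two reals.
  _⊔_ : ℝ → ℝ → ℝ
  x ⊔ y = mkℝ (λ n → seq x n ℚ.⊔ seq y n) λ ε 0<ε →
    let M , p = cauchy x ε 0<ε
        N , q = cauchy y ε 0<ε
    in M ℕ.⊔ N , λ m n h k →
      ⊔-close {seq x m} {seq y m} {seq x n} {seq y n}
        (p m n (ℕₚ.m⊔n≤o⇒m≤o M N h) (ℕₚ.m⊔n≤o⇒m≤o M N k))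
        (q m n (ℕₚ.m⊔n≤o⇒n≤o M N h) (ℕₚ.m⊔n≤o⇒n≤o M N k))

  x≤y⇒x⊔y≈y : ∀ {x y} → x ≤ y → x ⊔ y ≈ y
  x≤y⇒x⊔y≈y {x} {y} x≤y ε 0<ε with x≤y ε 0<ε
  ... | N , p = N , λ n h → <⇒close
    (⊔-lub-< (p n h) (p<p+ε 0<ε))
    (ℚₚ.≤-<-trans (ℚₚ.p≤q⊔p (seq x n) (seq y n)) (p<p+ε 0<ε))

  ≤-respˡ-≈ : ∀ {x y z} → x ≈ y → y ≤ z → x ≤ z
  ≤-respˡ-≈ {x} {y} {z} x≈y y≤z ε 0<ε
    with x≈y (ε ℚ.* ½) (half-pos 0<ε) | y≤z (ε ℚ.* ½) (half-pos 0<ε)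
  ... | M , p | N , q = M ℕ.⊔ N , λ n h → begin-strict
      seq x n
    <⟨ close⇒< {seq x n} {seq y n} (p n (ℕₚ.m⊔n≤o⇒m≤o M N h)) ⟩
      seq y n ℚ.+ ε ℚ.* ½
    <⟨ ℚₚ.+-monoˡ-< (ε ℚ.* ½) (q n (ℕₚ.m⊔n≤o⇒n≤o M N h)) ⟩
      seq z n ℚ.+ ε ℚ.* ½ ℚ.+ ε ℚ.* ½
    ≡⟨ trans (ℚₚ.+-assoc (seq z n) _ _) (cong (seq z n ℚ.+_) (halves ε)) ⟩
      seq z n ℚ.+ ε ∎
    where open ℚₚ.≤-Reasoning

  +-comm-≤ : ∀ {x y z} → x + y ≤ z → y + x ≤ z
  +-comm-≤ {x} {y} x+y≤z ε 0<ε with x+y≤z ε 0<ε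
  ... | N , p = N , λ n h → subst (ℚ._< _) (ℚₚ.+-comm (seq x n) (seq y n)) (p n h)

  nonnegative-seq : ∀ {x y} → (∀ i → 0ℚ ℚ.≤ seq x i) → x ≈ y → 0ℝ ≤ y
  nonnegative-seq {x} {y} 0≤x x≈y ε 0<ε with x≈y ε 0<ε
  ... | N , p = N , λ n h → ℚₚ.≤-<-trans (0≤x n) (close⇒< {seq x n} {seq y n} (p n h))

  -- An infinite matrix is TP if it equals one whose rational matrices, formed by
  -- the i-th terms of the entries, all have nonnegative minors.
  pointwise-TP : ∀ {a b : InfiniteMatrix} → (∀ n k → a n k ≈ b n k) →
    (∀ i → RationalMinors.TotallyPositive (λ n k → seq (a n k) i)) → IsTP b
  pointwise-TP {a} {b} a≈b TP rows cols rows-inc cols-inc =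
    nonnegative-seq {det (λ i j → a (rows i) (cols j))} {det (λ i j → b (rows i) (cols j))}
      (λ i → subst (0ℚ ℚ.≤_) (sym (seq-det (λ i j → a (rows i) (cols j)) i))
        (TP i rows rows-inc cols cols-inc))
      (det-cong {M = λ i j → a (rows i) (cols j)} {λ i j → b (rows i) (cols j)}
        λ i j → a≈b (rows i) (cols j))

  -- Substitutes for sequences of reals, equal to them under suitable hypotheses
  -- but satisfying the inequalities at every term of the Cauchy sequences.

  -- The maximum with 0.
  positivePart : (ℕ → ℝ) → ℕ → ℝ
  positivePart f k = 0ℝ ⊔ f k

  -- The maximum of s and the sums that the dominance hypothesis bounds by s.
  dominate : (x y s : ℕ → ℝ) → ℕ → ℝ
  dominate x y s zero    = x 0 ⊔ s 0
  dominate x y s (suc k) = (x (suc k) + y k) ⊔ s (suc k)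

  dominate-≈ : (x x′ y y′ s : ℕ → ℝ) → (∀ k → x′ k ≈ x k) → (∀ k → y′ k ≈ y k) →
    x 0 ≤ s 0 → (∀ k → x (suc k) + y k ≤ s (suc k)) →
    ∀ k → dominate x′ y′ s k ≈ s k
  dominate-≈ x x′ y y′ s x′≈x y′≈y x₀≤s₀ dominant zero =
    x≤y⇒x⊔y≈y {x′ 0} {s 0} (≤-respˡ-≈ {x′ 0} {x 0} {s 0} (x′≈x 0) x₀≤s₀)
  dominate-≈ x x′ y y′ s x′≈x y′≈y x₀≤s₀ dominant (suc k) =
    x≤y⇒x⊔y≈y {x′ (suc k) + y′ k} {s (suc k)}
      (≤-respˡ-≈ {x′ (suc k) + y′ k} {x (suc k) + y k} {s (suc k)}
        (+-cong {x′ (suc k)} {x (suc k)} {y′ k} {y k} (x′≈x (suc k)) (y′≈y k)) (dominant k))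

open RealApproximation

theorem2p8 : (r s t : ℕ → ℝ) →
    (∀ k → 1 ℕ.≤ k → 0ℝ ≤ r k) →
    (∀ k → 0ℝ ≤ s k) →
    (∀ k → 1 ℕ.≤ k → 0ℝ ≤ t k) →
    ( r 1 ≤ s 0 →
    (∀ k → 1 ℕ.≤ k → r (suc k) + t k ≤ s k) →
    IsTP (recMatrix r s t) )
    ×
    ( t 1 ≤ s 0 →
    (∀ k → 1 ℕ.≤ k → r k + t (suc k) ≤ s k) →
    IsTP (recMatrix r s t) )
theorem2p8 r s t 0≤r _ 0≤t = row-dominant , column-dominant
  where
  r⁺ t⁺ : ℕ → ℝ
  r⁺ = positivePart r
  t⁺ = positivePart t

  r⁺≈r : ∀ k → r⁺ (suc k) ≈ r (suc k)
  r⁺≈r k = x≤y⇒x⊔y≈y {0ℝ} {r (suc k)} (0≤r (suc k) (s≤s z≤n))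
  t⁺≈t : ∀ k → t⁺ (suc k) ≈ t (suc k)
  t⁺≈t k = x≤y⇒x⊔y≈y {0ℝ} {t (suc k)} (0≤t (suc k) (s≤s z≤n))

  0≤r⁺ : ∀ i k → 0ℚ ℚ.≤ seq (r⁺ k) i
  0≤r⁺ i k = ℚₚ.p≤p⊔q 0ℚ (seq (r k) i)
  0≤t⁺ : ∀ i k → 0ℚ ℚ.≤ seq (t⁺ k) i
  0≤t⁺ i k = ℚₚ.p≤p⊔q 0ℚ (seq (t k) i)

  row-dominant : r 1 ≤ s 0 → (∀ k → 1 ℕ.≤ k → r (suc k) + t k ≤ s k) →
    IsTP (recMatrix r s t)
  row-dominant r₁≤s₀ dominant = pointwise-TP {recMatrix r⁺ s⁺ t⁺} {recMatrix r s t}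
    (recMatrix-cong {r⁺} {r} {s⁺} {s} {t⁺} {t} r⁺≈r
      (dominate-≈ (r ∘ suc) (r⁺ ∘ suc) (t ∘ suc) (t⁺ ∘ suc) s r⁺≈r t⁺≈t
        r₁≤s₀ (λ k → dominant (suc k) (s≤s z≤n)))
      t⁺≈t)
    -- The i-th terms of the entries satisfy the same recurrence by computation.
    λ i → RationalMinors.row-dominant⇒TP
      (λ k → seq (r⁺ k) i) (λ k → seq (s⁺ k) i) (λ k → seq (t⁺ k) i)
      (0≤r⁺ i ∘ suc) (0≤t⁺ i ∘ suc)
      (λ n k → seq (recMatrix r⁺ s⁺ t⁺ n k) i)
      refl (λ _ → refl) (λ _ → refl) (λ _ _ → refl)
      (ℚₚ.p≤p⊔q _ _) (λ k → ℚₚ.p≤p⊔q _ _)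
    where
    s⁺ : ℕ → ℝ
    s⁺ = dominate (r⁺ ∘ suc) (t⁺ ∘ suc) s

  column-dominant : t 1 ≤ s 0 → (∀ k → 1 ℕ.≤ k → r k + t (suc k) ≤ s k) →
    IsTP (recMatrix r s t)
  column-dominant t₁≤s₀ dominant = pointwise-TP {recMatrix r⁺ s⁺ t⁺} {recMatrix r s t}
    (recMatrix-cong {r⁺} {r} {s⁺} {s} {t⁺} {t} r⁺≈r
      (dominate-≈ (t ∘ suc) (t⁺ ∘ suc) (r ∘ suc) (r⁺ ∘ suc) s t⁺≈t r⁺≈r
        t₁≤s₀ (λ k → +-comm-≤ {r (suc k)} {t (2 ℕ.+ k)} {s (suc k)} (dominant (suc k) (s≤s z≤n))))
      t⁺≈t)
    -- The i-th terms of the entries satisfy the same recurrence by computation.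
    λ i → RationalMinors.column-dominant⇒TP
      (λ k → seq (r⁺ k) i) (λ k → seq (s⁺ k) i) (λ k → seq (t⁺ k) i)
      (0≤r⁺ i ∘ suc) (0≤t⁺ i ∘ suc)
      (λ n k → seq (recMatrix r⁺ s⁺ t⁺ n k) i)
      refl (λ _ → refl) (λ _ → refl) (λ _ _ → refl)
      (ℚₚ.p≤p⊔q _ _) (λ k → ℚₚ.p≤p⊔q _ _)
    where
    s⁺ : ℕ → ℝ
    s⁺ = dominate (t⁺ ∘ suc) (r⁺ ∘ suc) s
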